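{- Let $(R_1,\mathcal L_1)$ and $(R_2,\mathcal L_2)$ be sets with a language. Let $\sim$ be an equivalence relation on $R_2$ and let $\pi:R_2\to R_2/{\sim}$ be the projection. Let $d:R_1\to R_2/{\sim}$ be an injective map such that: (1) for all constants $c\in\mathcal L_1$, $\overline d(c)\subset R_2$ is a Diophantine set; (2) for all $k$-ary functions $f\in\mathcal L_1$, $\overline d(\{(\vec x,f(\vec x))\mid\vec x\in R_1^k\})$ is a Diophantine set; (3) for all relations $S\in\mathcal L_1$, $\overline d(S)$ is a Diophantine set; (4) the set $\overline d(R_1)$ is Diophantine; (5) the set $\{(x,y)\in R_2^2\mid x\sim y\}$ or the set $\{(x,y)\in R_2^2\mid x,y\in\overline d(R_1),\ x\sim y\}$ is Diophantine. Then $d$ is a Diophantine equivalence map.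
   Context: A "set with a language" $(R,\mathcal L)$ is a set $R$ together with a language $\mathcal L$ (constants, functions, relations) with an interpretation in $R$; every language contains a constant $0$ and equality. Terms of $\mathcal L$ are built from constants of $\mathcal L$ and variables using functions of $\mathcal L$; a basic formula has the form $(t_1,\ldots,t_k)\in R'$ with $R'\in\mathcal L$ a $k$-ary relation (possibly equality) and $t_i$ terms. $S\subset R^k$ is Diophantine if $S=\{\vec x\in R^k\mid\exists\vec y\in R^l\ (f_1\wedge\cdots\wedge f_r)\}$ for some basic formulas $f_i$. For $d:R_1\to R_2/{\sim}$ and $S\subset R_1^k$, let $d(S)$ be the coordinatewise image and $\overline d(S)=\{\vec x\in R_2^k\mid(\pi(x_1),\ldots,\pi(x_k))\in d(S)\}$; write $\overline d(c)$ for $\overline d(\{c\})$. The map $d$ is a Diophantine equivalence map if for all $k$ and all Diophantine $S\subset R_1^k$ the set $\overline d(S)\subset R_2^k$ is Diophantine. -}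

module Defs where

open import Level using (Level; _⊔_; suc)
open import Data.Nat.Base as ℕ using (ℕ)
open import Data.Fin.Base using (Fin)
open import Data.Vec.Base using (Vec; []; _∷_; _++_; _∷ʳ_; lookup; map)
open import Data.Vec.Relation.Binary.Pointwise.Inductive using (Pointwise)
open import Data.List.Base using (List)
open import Data.List.Relation.Unary.All using (All)
open import Data.Product.Base using (∃; ∃-syntax; _×_)
open import Function.Bundles using (_⟶ₛ_; _⟨$⟩_)
import Function.Construct.Identity as Identity
open import Relation.Binary.Bundles using (Setoid)
open import Relation.Binary.Core using (Rel)
open import Relation.Binary.Structures using (IsEquivalence)
open import Relation.Binary.PropositionalEquality using (_≡_; refl; setoid)
open import Relation.Unary using (Pred; _≐_)

private
  variable
    a b e p r s ℓ : Level
    n k : ℕ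

-- Equality belongs to every language; it is built into `BasicFormula`, with
-- its standard interpretation, so `RelSym k` lists the other relations.
record Language (ℓ : Level) : Set (suc ℓ) where
  field
    ConSym : Set ℓ
    0#     : ConSym
    FunSym : ℕ → Set ℓ
    RelSym : ℕ → Set ℓ

record SetWithLanguage (r ℓ s : Level) : Set (suc (r ⊔ ℓ ⊔ s)) where
  field
    Carrier  : Set r
    language : Language ℓ
  open Language language public
  field
    ⟦_⟧ᶜ : ConSym → Carrier
    ⟦_⟧ᶠ : FunSym k → Vec Carrier k → Carrier
    ⟦_⟧ʳ : RelSym k → Pred (Vec Carrier k) s

module _ (L : Language ℓ) where
  open Language L

  data Term (n : ℕ) : Set ℓ where
    var : Fin n → Term n
    con : ConSym → Term n
    app : FunSym k → Vec (Term n) k → Term n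

  data BasicFormula (n : ℕ) : Set ℓ where
    rel : RelSym k → Vec (Term n) k → BasicFormula n
    equ : Term n → Term n → BasicFormula n

module Semantics (𝓡 : SetWithLanguage r ℓ s) where
  open SetWithLanguage 𝓡

  eval  : Vec Carrier n → Term language n → Carrier
  evals : Vec Carrier n → Vec (Term language n) k → Vec Carrier k

  eval ρ (var i)    = lookup ρ i
  eval ρ (con c)    = ⟦ c ⟧ᶜ
  eval ρ (app f ts) = ⟦ f ⟧ᶠ (evals ρ ts)

  evals ρ []       = []
  evals ρ (t ∷ ts) = eval ρ t ∷ evals ρ ts

  -- A data type rather than a function into Set, since the two cases live in
  -- different universes.
  data _⊨_ (ρ : Vec Carrier n) : BasicFormula language n → Set (r ⊔ ℓ ⊔ s) where
    rel : {R : RelSym k} {ts : Vec (Term language n) k} →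
          ⟦ R ⟧ʳ (evals ρ ts) → ρ ⊨ rel R ts
    equ : {t u : Term language n} → eval ρ t ≡ eval ρ u → ρ ⊨ equ t u

  IsDiophantine : Pred (Vec Carrier k) p → Set (r ⊔ ℓ ⊔ s ⊔ p)
  IsDiophantine {k = k} S =
    ∃[ l ] ∃ λ (fs : List (BasicFormula language (k ℕ.+ l))) →
      S ≐ λ x → ∃ λ (y : Vec Carrier l) → All ((x ++ y) ⊨_) fs

open Semantics public using (IsDiophantine)

-- B/∼ as a setoid: its elements are those of B, compared by ∼.
Quotient : {B : Set b} {_∼_ : Rel B e} → IsEquivalence _∼_ → Setoid b e
Quotient eq = record { isEquivalence = eq }

π : {B : Set b} {_∼_ : Rel B e} (eq : IsEquivalence _∼_) →
    setoid B ⟶ₛ Quotient eq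
π eq = record { to = λ x → x ; cong = λ { refl → IsEquivalence.refl eq } }

module _ {A : Set a} {B : Set b} {_∼_ : Rel B e} {eq : IsEquivalence _∼_}
         (d : setoid A ⟶ₛ Quotient eq) where

  image : Pred (Vec A k) p → Pred (Vec (Setoid.Carrier (Quotient eq)) k) (a ⊔ b ⊔ e ⊔ p)
  image S y = ∃ λ x → S x × Pointwise (Setoid._≈_ (Quotient eq)) (map (d ⟨$⟩_) x) y

  overline : Pred (Vec A k) p → Pred (Vec B k) (a ⊔ b ⊔ e ⊔ p)
  overline S x = image S (map (π eq ⟨$⟩_) x)

-- The level p of the subsets S ranges over an arbitrary but fixed universe.
IsDiophantineEquivalenceMap :
  ∀ p {r₁ ℓ₁ s₁ r₂ ℓ₂ s₂ e}
  (𝓡₁ : SetWithLanguage r₁ ℓ₁ s₁) (𝓡₂ : SetWithLanguage r₂ ℓ₂ s₂) →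
  let open SetWithLanguage in
  {_∼_ : Rel (Carrier 𝓡₂) e} {eq : IsEquivalence _∼_} →
  setoid (Carrier 𝓡₁) ⟶ₛ Quotient eq →
  Set (suc p ⊔ r₁ ⊔ ℓ₁ ⊔ s₁ ⊔ r₂ ⊔ ℓ₂ ⊔ s₂ ⊔ e)
IsDiophantineEquivalenceMap p 𝓡₁ 𝓡₂ d =
  ∀ k (S : Pred (Vec (SetWithLanguage.Carrier 𝓡₁) k) p) →
  IsDiophantine 𝓡₁ S → IsDiophantine 𝓡₂ (overline d S)

graph : {A : Set a} → (Vec A k → A) → Pred (Vec A (ℕ.suc k)) a
graph f v = ∃ λ x → v ≡ x ∷ʳ f x

pairs : {A : Set a} → (A → A → Set p) → Pred (Vec A 2) p
pairs P (x ∷ y ∷ []) = P x y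

{-# OPTIONS --safe #-}
module Submission where

-- Call a subset S of a power of R₁ transferable when the set overline d S is
-- Diophantine over R₂.  The theorem says that every Diophantine set is
-- transferable.
--
-- Diophantine sets over any set with a language are closed under finite
-- intersection, rearrangement of coordinates and projection; each closure is
-- a renaming of variables in the defining formulas.  Injectivity of d means
-- that a tuple of R₂ represents at most one tuple of R₁; this gives the first
-- two of the following identities, while the third needs only that every
-- element of R₁ has a representative:
--
--   overline d (S ∩ T)  =  overline d S ∩ overline d T,
--   overline d (ρ⁻¹ S)  =  overline d U ∩ ρ⁻¹ (overline d S),
--   overline d (∃ S)    =  ∃ (overline d S).
--
-- Here ρ⁻¹ S is the set of tuples whose rearrangement by ρ lies in S, and
-- overline d U, the set of all tuples representing some tuple, is Diophantine
-- as a power of overline d R₁.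
-- Hence transferable sets enjoy the same closure properties
-- (transferable-∩, transferable-rearrange, transferable-∃).
-- The diagonal of R₁ is transferable: its overline is the relation ∼
-- restricted to overline d U.  Graphs of terms are then transferable by
-- induction on terms, an application f(t₁,…,tₖ) being handled by quantifying
-- over the values of the tᵢ.  Quantifying over the values of the terms in a
-- basic formula shows that its solution set is transferable, and Diophantine
-- sets are projections of finite intersections of such sets.

open import Defs
open import Data.Fin.Base using (Fin; zero; suc; _↑ˡ_; _↑ʳ_)
open import Data.List.Base as List using (List)
open import Data.List.Relation.Unary.All as All using (All)
import Data.List.Relation.Unary.All.Properties as All
open import Data.Nat.Base using (ℕ; _+_)
open import Data.Product.Base using (∃; _×_; _,_)
open import Data.Sum.Base using (_⊎_; inj₁; inj₂)
open import Data.Vec.Base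
  using (Vec; []; _∷_; _++_; _∷ʳ_; lookup; map; allFin; splitAt)
open import Data.Vec.Properties
  using ( map-++; map-∘; map-cong; map-∷ʳ; map-lookup-allFin; lookup-map
        ; lookup-++ˡ; lookup-++ʳ; ++-injective; ∷ʳ-injective; ∷-injective)
open import Data.Vec.Relation.Binary.Pointwise.Inductive
  using (Pointwise; []; _∷_)
open import Function.Base using (_∘_)
open import Function.Bundles using (_⟶ₛ_; _⟨$⟩_)
open import Function.Definitions using (Injective)
open import Level using (Level)
open import Relation.Binary.Core using (Rel)
open import Relation.Binary.Structures using (IsEquivalence)
open import Relation.Binary.PropositionalEquality
  using (_≡_; refl; sym; trans; cong; cong₂; subst; setoid)
open import Relation.Unary using (Pred; U; ｛_｝; _≐_; _∩_)

private
  variable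
    a p q r ℓ s : Level
    A : Set a
    k l m n : ℕ

-- Rearranging coordinates

-- A vector ρ of indices stands for the map taking a tuple v to the tuple of
-- its entries at these indices.
infixl 8 _!_

_!_ : Vec A m → Vec (Fin m) k → Vec A k
v ! ρ = map (lookup v) ρ

lefts : ∀ m n → Vec (Fin (m + n)) m
lefts m n = map (_↑ˡ n) (allFin m)

rights : ∀ m n → Vec (Fin (m + n)) n
rights m n = map (m ↑ʳ_) (allFin n)

!-++ : (v : Vec A m) (ρ : Vec (Fin m) k) (σ : Vec (Fin m) l) →
       v ! (ρ ++ σ) ≡ v ! ρ ++ v ! σ
!-++ v = map-++ (lookup v)

!-left : (x : Vec A m) (y : Vec A n) (ρ : Vec (Fin m) k) →
         (x ++ y) ! map (_↑ˡ n) ρ ≡ x ! ρ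
!-left x y ρ =
  trans (sym (map-∘ (lookup (x ++ y)) _ ρ)) (map-cong (lookup-++ˡ x y) ρ)

!-right : (x : Vec A m) (y : Vec A n) (ρ : Vec (Fin n) k) →
          (x ++ y) ! map (m ↑ʳ_) ρ ≡ y ! ρ
!-right x y ρ =
  trans (sym (map-∘ (lookup (x ++ y)) _ ρ)) (map-cong (lookup-++ʳ x y) ρ)

!-lefts : (x : Vec A m) (y : Vec A n) → (x ++ y) ! lefts m n ≡ x
!-lefts x y = trans (!-left x y (allFin _)) (map-lookup-allFin x)

!-rights : (x : Vec A m) (y : Vec A n) → (x ++ y) ! rights m n ≡ y
!-rights x y = trans (!-right x y (allFin _)) (map-lookup-allFin y)

-- The rearrangement acting as ρ on an initial and as σ on a final block.
infixr 6 _⊕_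

_⊕_ : Vec (Fin m) k → Vec (Fin n) l → Vec (Fin (m + n)) (k + l)
_⊕_ {m = m} {n = n} ρ σ = map (_↑ˡ n) ρ ++ map (m ↑ʳ_) σ

!-⊕ : (x : Vec A m) (y : Vec A n) (ρ : Vec (Fin m) k) (σ : Vec (Fin n) l) →
      (x ++ y) ! (ρ ⊕ σ) ≡ x ! ρ ++ y ! σ
!-⊕ x y ρ σ =
  trans (!-++ (x ++ y) (map (_↑ˡ _) ρ) _) (cong₂ _++_ (!-left x y ρ) (!-right x y σ))

-- Renaming variables in formulas

module _ {L : Language ℓ} where

  rename  : Vec (Fin m) n → Term L n → Term L m
  renames : Vec (Fin m) n → Vec (Term L n) k → Vec (Term L m) k

  rename ρ (var i)    = var (lookup ρ i)
  rename ρ (con c)    = con c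
  rename ρ (app f ts) = app f (renames ρ ts)

  renames ρ []       = []
  renames ρ (t ∷ ts) = rename ρ t ∷ renames ρ ts

  renameᶠ : Vec (Fin m) n → BasicFormula L n → BasicFormula L m
  renameᶠ ρ (rel R ts) = rel R (renames ρ ts)
  renameᶠ ρ (equ t u)  = equ (rename ρ t) (rename ρ u)

module _ (𝓡 : SetWithLanguage r ℓ s) where
  open SetWithLanguage 𝓡
  open Semantics 𝓡 hiding (IsDiophantine)

  eval-rename : (v : Vec Carrier m) (ρ : Vec (Fin m) n) (t : Term language n) →
                eval v (rename ρ t) ≡ eval (v ! ρ) t
  evals-rename : (v : Vec Carrier m) (ρ : Vec (Fin m) n)
                 (ts : Vec (Term language n) k) →
                 evals v (renames ρ ts) ≡ evals (v ! ρ) ts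

  eval-rename v ρ (var i)    = sym (lookup-map i (lookup v) ρ)
  eval-rename v ρ (con c)    = refl
  eval-rename v ρ (app f ts) = cong ⟦ f ⟧ᶠ (evals-rename v ρ ts)

  evals-rename v ρ []       = refl
  evals-rename v ρ (t ∷ ts) = cong₂ _∷_ (eval-rename v ρ t) (evals-rename v ρ ts)

  ⊨-rename⁺ : (v : Vec Carrier m) (ρ : Vec (Fin m) n)
              {φ : BasicFormula language n} → (v ! ρ) ⊨ φ → v ⊨ renameᶠ ρ φ
  ⊨-rename⁺ v ρ (rel {R = R} {ts} h) =
    rel (subst ⟦ R ⟧ʳ (sym (evals-rename v ρ ts)) h)
  ⊨-rename⁺ v ρ (equ {t} {u} h) =
    equ (trans (eval-rename v ρ t) (trans h (sym (eval-rename v ρ u))))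

  ⊨-rename⁻ : (v : Vec Carrier m) (ρ : Vec (Fin m) n)
              (φ : BasicFormula language n) → v ⊨ renameᶠ ρ φ → (v ! ρ) ⊨ φ
  ⊨-rename⁻ v ρ (rel R ts) (rel h) =
    rel (subst ⟦ R ⟧ʳ (evals-rename v ρ ts) h)
  ⊨-rename⁻ v ρ (equ t u) (equ h) =
    equ (trans (sym (eval-rename v ρ t)) (trans h (eval-rename v ρ u)))

  private
    -- The common solutions of a list of formulas.
    Sat : List (BasicFormula language n) → Pred (Vec Carrier n) _
    Sat fs v = All (v ⊨_) fs

  Sat-rename⁺ : {v : Vec Carrier m} {w : Vec Carrier n} (ρ : Vec (Fin m) n)
                {fs : List (BasicFormula language n)} → v ! ρ ≡ w →
                Sat fs w → Sat (List.map (renameᶠ ρ) fs) v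
  Sat-rename⁺ {v = v} ρ refl = All.map⁺ ∘ All.map (⊨-rename⁺ v ρ)

  Sat-rename⁻ : {v : Vec Carrier m} {w : Vec Carrier n} (ρ : Vec (Fin m) n)
                {fs : List (BasicFormula language n)} → v ! ρ ≡ w →
                Sat (List.map (renameᶠ ρ) fs) v → Sat fs w
  Sat-rename⁻ {v = v} ρ refl = All.map (λ {φ} → ⊨-rename⁻ v ρ φ) ∘ All.map⁻

-- Closure properties of Diophantine sets

  diophantine-cong : {S : Pred (Vec Carrier k) p} {T : Pred (Vec Carrier k) q} →
                     S ≐ T → IsDiophantine 𝓡 S → IsDiophantine 𝓡 T
  diophantine-cong (S⊆T , T⊆S) (l , fs , to , from) =
    l , fs , (λ t → to (T⊆S t)) , (λ h → S⊆T (from h))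

  diophantine-U : IsDiophantine 𝓡 {k = k} U
  diophantine-U = 0 , List.[] , (λ _ → [] , All.[]) , _

  diophantine-rearrange : (ρ : Vec (Fin m) k) {S : Pred (Vec Carrier k) p} →
                          IsDiophantine 𝓡 S → IsDiophantine 𝓡 (λ v → S (v ! ρ))
  diophantine-rearrange ρ (l , fs , to , from) =
    l , List.map (renameᶠ (ρ ⊕ allFin l)) fs
      , (λ {x} s → let y , h = to s in y , Sat-rename⁺ (ρ ⊕ allFin l) (eq x y) h)
      , (λ {x} (y , h) → from (y , Sat-rename⁻ (ρ ⊕ allFin l) (eq x y) h))
    where
    eq : ∀ x (y : Vec Carrier l) → (x ++ y) ! (ρ ⊕ allFin l) ≡ x ! ρ ++ y
    eq x y = trans (!-⊕ x y ρ (allFin l)) (cong (x ! ρ ++_) (map-lookup-allFin y))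

  diophantine-∩ : {S : Pred (Vec Carrier k) p} {T : Pred (Vec Carrier k) q} →
                  IsDiophantine 𝓡 S → IsDiophantine 𝓡 T → IsDiophantine 𝓡 (S ∩ T)
  diophantine-∩ {k = k} (l , fs , toS , fromS) (m , gs , toT , fromT) =
    l + m , List.map (renameᶠ ρ) fs List.++ List.map (renameᶠ σ) gs
      , (λ {x} (s , t) →
          let y , h = toS s ; z , h′ = toT t in
          y ++ z , All.++⁺ (Sat-rename⁺ ρ (eqρ x y z) h) (Sat-rename⁺ σ (eqσ x y z) h′))
      , λ {x} (w , h) → from x w (splitAt l w) h
    where
    ρ = allFin k ⊕ lefts l m
    σ = allFin k ⊕ rights l m

    eqρ : ∀ x y z → (x ++ (y ++ z)) ! ρ ≡ x ++ y
    eqρ x y z = trans (!-⊕ x (y ++ z) (allFin k) (lefts l m))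
                      (cong₂ _++_ (map-lookup-allFin x) (!-lefts y z))

    eqσ : ∀ x y z → (x ++ (y ++ z)) ! σ ≡ x ++ z
    eqσ x y z = trans (!-⊕ x (y ++ z) (allFin k) (rights l m))
                      (cong₂ _++_ (map-lookup-allFin x) (!-rights y z))

    from : ∀ x w → (∃ λ y → ∃ λ z → w ≡ y ++ z) →
           Sat (List.map (renameᶠ ρ) fs List.++ List.map (renameᶠ σ) gs) (x ++ w) → _
    from x _ (y , z , refl) h =
      let h₁ , h₂ = All.++⁻ (List.map (renameᶠ ρ) fs) h in
      fromS (y , Sat-rename⁻ ρ (eqρ x y z) h₁) , fromT (z , Sat-rename⁻ σ (eqσ x y z) h₂)

  diophantine-∃ : {S : Pred (Vec Carrier (k + l)) p} →
                  IsDiophantine 𝓡 S → IsDiophantine 𝓡 (λ x → ∃ λ y → S (x ++ y))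
  diophantine-∃ {k = k} {l} {S = S} (m , fs , to , from) =
    l + m , List.map (renameᶠ ρ) fs
      , (λ {x} (y , s) → let z , h = to s in y ++ z , Sat-rename⁺ ρ (eq x y z) h)
      , λ {x} (w , h) → back x w (splitAt l w) h
    where
    -- Reassociates k + (l + m) to (k + l) + m.
    ρ : Vec (Fin (k + (l + m))) ((k + l) + m)
    ρ = (allFin k ⊕ lefts l m) ++ map (k ↑ʳ_) (rights l m)

    eq : ∀ x y z → (x ++ (y ++ z)) ! ρ ≡ (x ++ y) ++ z
    eq x y z = trans (!-++ (x ++ (y ++ z)) (allFin k ⊕ lefts l m) _) (cong₂ _++_
      (trans (!-⊕ x (y ++ z) (allFin k) (lefts l m))
             (cong₂ _++_ (map-lookup-allFin x) (!-lefts y z)))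
      (trans (!-right x (y ++ z) (rights l m)) (!-rights y z)))

    back : ∀ x w → (∃ λ y → ∃ λ z → w ≡ y ++ z) →
           Sat (List.map (renameᶠ ρ) fs) (x ++ w) → ∃ λ y → S (x ++ y)
    back x _ (y , z , refl) h = y , from (z , Sat-rename⁻ ρ (eq x y z) h)

-- Representatives of tuples under an injection into a quotient

module Transfer
  {r₁ ℓ₁ s₁ r₂ ℓ₂ s₂ e : Level}
  (𝓡₁ : SetWithLanguage r₁ ℓ₁ s₁) (𝓡₂ : SetWithLanguage r₂ ℓ₂ s₂)
  {_∼_ : Rel (SetWithLanguage.Carrier 𝓡₂) e} (∼-equiv : IsEquivalence _∼_)
  (d : setoid (SetWithLanguage.Carrier 𝓡₁) ⟶ₛ Quotient ∼-equiv)
  (d-injective : Injective _≡_ _∼_ (d ⟨$⟩_))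
  where

  open SetWithLanguage 𝓡₁
  open Semantics 𝓡₁ hiding (IsDiophantine)
  open IsEquivalence ∼-equiv
    renaming (refl to ∼-refl; sym to ∼-sym; trans to ∼-trans)

  Carrier₂ : Set r₂
  Carrier₂ = SetWithLanguage.Carrier 𝓡₂

  -- Each entry of x lies in the class that d assigns to the corresponding
  -- entry of c; overline d S x unfolds to ∃ λ c → S c × x represents c.
  _represents_ : Vec Carrier₂ k → Vec Carrier k → Set _
  x represents c = Pointwise _∼_ (map (d ⟨$⟩_) c) (map (π ∼-equiv ⟨$⟩_) x)

  represented-unique : {b c : Vec Carrier k} (x : Vec Carrier₂ k) →
                       x represents b → x represents c → b ≡ c
  represented-unique {b = []}    {[]}    []      []       []       = refl
  represented-unique {b = _ ∷ _} {_ ∷ _} (_ ∷ x) (h ∷ hs) (h′ ∷ hs′) =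
    cong₂ _∷_ (d-injective (∼-trans h (∼-sym h′))) (represented-unique x hs hs′)

  representative : (c : Vec Carrier k) → ∃ (_represents c)
  representative []      = [] , []
  representative (c ∷ cs) =
    let x , h = representative cs in (d ⟨$⟩ c) ∷ x , ∼-refl ∷ h

  represents-lookup : (c : Vec Carrier k) (x : Vec Carrier₂ k) → x represents c →
                      ∀ i → (d ⟨$⟩ lookup c i) ∼ lookup x i
  represents-lookup (_ ∷ _) (_ ∷ _) (h ∷ _)  zero    = h
  represents-lookup (_ ∷ c) (_ ∷ x) (_ ∷ hs) (suc i) = represents-lookup c x hs i

  represents-! : (ρ : Vec (Fin m) k) {c : Vec Carrier m} {x : Vec Carrier₂ m} →
                 x represents c → (x ! ρ) represents (c ! ρ)
  represents-! []      h = []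
  represents-! (i ∷ ρ) h = represents-lookup _ _ h i ∷ represents-! ρ h

  represents-++⁺ : {b : Vec Carrier k} {x : Vec Carrier₂ k}
                   {c : Vec Carrier l} {y : Vec Carrier₂ l} →
                   x represents b → y represents c → (x ++ y) represents (b ++ c)
  represents-++⁺ {b = []}    {[]}    []       h′ = h′
  represents-++⁺ {b = _ ∷ _} {_ ∷ _} (h ∷ hs) h′ = h ∷ represents-++⁺ hs h′

  represents-++⁻ : (b : Vec Carrier k) (x : Vec Carrier₂ k)
                   {c : Vec Carrier l} {y : Vec Carrier₂ l} →
                   (x ++ y) represents (b ++ c) → x represents b
  represents-++⁻ []      []      _        = []
  represents-++⁻ (_ ∷ b) (_ ∷ x) (h ∷ hs) = h ∷ represents-++⁻ b x hs

-- Closure properties of transferable sets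

  -- A set of tuples over R₁ is transferable when the set of its
  -- representatives is Diophantine over R₂.
  Transferable : Pred (Vec Carrier k) p → Set _
  Transferable S = IsDiophantine 𝓡₂ (overline d S)

  transferable-cong : {S : Pred (Vec Carrier k) p} {T : Pred (Vec Carrier k) q} →
                      S ≐ T → Transferable S → Transferable T
  transferable-cong (S⊆T , T⊆S) = diophantine-cong 𝓡₂
    ((λ (c , s , h) → c , S⊆T s , h) , (λ (c , t , h) → c , T⊆S t , h))

  transferable-∩ : {S : Pred (Vec Carrier k) p} {T : Pred (Vec Carrier k) q} →
                   Transferable S → Transferable T → Transferable (S ∩ T)
  transferable-∩ {T = T} S-trans T-trans = diophantine-cong 𝓡₂
    ( (λ {x} ((b , s , h) , (c , t , h′)) →
         b , (s , subst T (represented-unique x h′ h) t) , h)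
    , (λ (c , (s , t) , h) → (c , s , h) , (c , t , h)))
    (diophantine-∩ 𝓡₂ S-trans T-trans)

  transferable-∃ : {S : Pred (Vec Carrier (k + l)) p} →
                   Transferable S → Transferable (λ b → ∃ λ c → S (b ++ c))
  transferable-∃ {k = k} {l} {S = S} S-trans = diophantine-cong 𝓡₂
    ( (λ {x} (y , a , s , h) → to x y (splitAt k a) s h)
    , (λ {x} (b , (c , s) , h) →
         let y , h′ = representative c in y , b ++ c , s , represents-++⁺ h h′))
    (diophantine-∃ 𝓡₂ S-trans)
    where
    to : ∀ x y {a} →
         (∃ λ (b : Vec Carrier k) → ∃ λ (c : Vec Carrier l) → a ≡ b ++ c) →
         S a → (x ++ y) represents a → overline d (λ b → ∃ λ c → S (b ++ c)) x
    to x y (b , c , refl) s h = b , (c , s) , represents-++⁻ b x h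

  module _ (range : IsDiophantine 𝓡₂ (overline d {k = 1} U)) where

    -- The k-tuples representing some tuple form the k-th power of the set of
    -- elements representing some element.
    transferable-U : Transferable {k = k} U
    transferable-U {k = 0} = diophantine-cong 𝓡₂
      ((λ { {[]} _ → [] , _ , [] }) , _) (diophantine-U 𝓡₂)
    transferable-U {k = ℕ.suc k} = diophantine-cong 𝓡₂
      ( (λ { {x ∷ xs} ((b ∷ [] , _ , h ∷ []) , (c , _ , h′)) →
               b ∷ c , _ , h ∷ subst (_represents c) (!-rights (x ∷ []) xs) h′ })
      , (λ { {x ∷ xs} (b ∷ c , _ , h ∷ hs) →
               (b ∷ [] , _ , h ∷ [])
             , (c , _ , subst (_represents c) (sym (!-rights (x ∷ []) xs)) hs) }))
      (diophantine-∩ 𝓡₂ (diophantine-rearrange 𝓡₂ (zero ∷ []) range)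
                        (diophantine-rearrange 𝓡₂ (rights 1 k) transferable-U))

    transferable-rearrange : (ρ : Vec (Fin m) k) {S : Pred (Vec Carrier k) p} →
                             Transferable S → Transferable (λ c → S (c ! ρ))
    transferable-rearrange ρ {S} S-trans = diophantine-cong 𝓡₂
      ( (λ {x} ((c , _ , h) , (b , s , h′)) →
           c , subst S (represented-unique (x ! ρ) h′ (represents-! ρ h)) s , h)
      , (λ (c , s , h) → (c , _ , h) , (c ! ρ , s , represents-! ρ h)))
      (diophantine-∩ 𝓡₂ transferable-U (diophantine-rearrange 𝓡₂ ρ S-trans))

    transferable-≡ :
      IsDiophantine 𝓡₂ (pairs _∼_)
        ⊎ IsDiophantine 𝓡₂ (pairs λ x y →
            (overline d U (x ∷ []) × overline d U (y ∷ [])) × x ∼ y) →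
      Transferable (pairs _≡_)
    transferable-≡ (inj₁ ∼-dioph) = diophantine-cong 𝓡₂
      ( (λ { {x ∷ y ∷ []} (x∼y , (c ∷ [] , _ , h ∷ [])) →
               c ∷ c ∷ [] , refl , h ∷ ∼-trans h x∼y ∷ [] })
      , (λ { {x ∷ y ∷ []} (c ∷ _ ∷ [] , refl , h ∷ h′ ∷ []) →
               ∼-trans (∼-sym h) h′ , (c ∷ [] , _ , h ∷ []) }))
      (diophantine-∩ 𝓡₂ ∼-dioph (diophantine-rearrange 𝓡₂ (zero ∷ []) range))
    transferable-≡ (inj₂ ∼-dioph) = diophantine-cong 𝓡₂
      ( (λ { {x ∷ y ∷ []} (((c ∷ [] , _ , h ∷ []) , _) , x∼y) →
               c ∷ c ∷ [] , refl , h ∷ ∼-trans h x∼y ∷ [] })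
      , (λ { {x ∷ y ∷ []} (c ∷ _ ∷ [] , refl , h ∷ h′ ∷ []) →
               ((c ∷ [] , _ , h ∷ []) , (c ∷ [] , _ , h′ ∷ [])) ,
               ∼-trans (∼-sym h) h′ }))
      ∼-dioph

-- Graphs of terms

    -- The graph of the function that a term in n variables defines.  The value
    -- precedes the arguments, so that it is found at index zero.
    termGraph : Term language n → Pred (Vec Carrier (ℕ.suc n)) _
    termGraph t v = ∃ λ x → v ≡ eval x t ∷ x

    -- The graph of the function into k-tuples defined by k terms; again the
    -- values come first.
    termsGraph : Vec (Term language n) k → Pred (Vec Carrier (k + n)) _
    termsGraph ts v = ∃ λ x → v ≡ evals x ts ++ x

    module _
      (diagonal : Transferable (pairs _≡_))
      (cons : ∀ (c : ConSym) → Transferable ｛ ⟦ c ⟧ᶜ ∷ [] ｝)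
      (funs : ∀ k (f : FunSym k) → Transferable (graph ⟦ f ⟧ᶠ))
      (rels : ∀ k (R : RelSym k) → Transferable ⟦ R ⟧ʳ)
      where

      transferable-term  : (t : Term language n) → Transferable (termGraph t)
      transferable-terms : (ts : Vec (Term language n) k) → Transferable (termsGraph ts)

      transferable-term (var i) = transferable-cong
        ( (λ { {y ∷ x} refl → x , refl })
        , (λ { (x , refl) → refl }))
        (transferable-rearrange (zero ∷ suc i ∷ []) diagonal)
      transferable-term (con c) = transferable-cong
        ( (λ { {y ∷ x} refl → x , refl })
        , (λ { (x , refl) → refl }))
        (transferable-rearrange (zero ∷ []) (cons c))
      -- The auxiliary block z holds the values of ts: the two sets intersected
      -- say that z = evals x ts and y = f z for the tuple (y ∷ x) ++ z.
      transferable-term {n = n} (app {k = k} f ts) = transferable-cong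
        ( (λ { {y ∷ x} (z , (x′ , p) , (z′ , q)) → to y x z p q })
        , (λ { (x , refl) →
                 let y = ⟦ f ⟧ᶠ (evals x ts) ; z = evals x ts in
                 z , (x , eqρ y x z) , (z , eqσ y x z) }))
        (transferable-∃ (transferable-∩
          (transferable-rearrange ρ (transferable-terms ts))
          (transferable-rearrange σ (funs k f))))
        where
        ρ : Vec (Fin (ℕ.suc n + k)) (k + n)
        ρ = rights (ℕ.suc n) k ++ map (_↑ˡ k) (rights 1 n)

        σ : Vec (Fin (ℕ.suc n + k)) (ℕ.suc k)
        σ = rights (ℕ.suc n) k ∷ʳ zero

        eqρ : ∀ y (x : Vec Carrier n) z → ((y ∷ x) ++ z) ! ρ ≡ z ++ x
        eqρ y x z = trans (!-++ ((y ∷ x) ++ z) (rights (ℕ.suc n) k) _) (cong₂ _++_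
          (!-rights (y ∷ x) z)
          (trans (!-left (y ∷ x) z (rights 1 n)) (!-rights (y ∷ []) x)))

        eqσ : ∀ y (x : Vec Carrier n) z → ((y ∷ x) ++ z) ! σ ≡ z ∷ʳ y
        eqσ y x z = trans (map-∷ʳ (lookup ((y ∷ x) ++ z)) zero (rights (ℕ.suc n) k))
                          (cong (_∷ʳ y) (!-rights (y ∷ x) z))

        to : ∀ y x z {x′ z′} →
             ((y ∷ x) ++ z) ! ρ ≡ evals x′ ts ++ x′ →
             ((y ∷ x) ++ z) ! σ ≡ z′ ∷ʳ ⟦ f ⟧ᶠ z′ →
             termGraph (app f ts) (y ∷ x)
        to y x z {x′} {z′} p q
          with ++-injective z (evals x′ ts) (trans (sym (eqρ y x z)) p)
             | ∷ʳ-injective z z′ (trans (sym (eqσ y x z)) q)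
        ... | refl , refl | refl , refl = x , refl

      transferable-terms [] = transferable-cong
        ((λ {x} _ → x , refl) , _) transferable-U
      transferable-terms {n = n} {k = ℕ.suc k} (t ∷ ts) = transferable-cong
        ( (λ { {y ∷ w} ((x′ , p) , (x , q)) → to y w p q })
        , (λ { (x , refl) →
                 (x , eqρ (eval x t) (evals x ts) x)
               , (x , !-rights (eval x t ∷ []) (evals x ts ++ x)) }))
        (transferable-∩
          (transferable-rearrange ρ (transferable-term t))
          (transferable-rearrange σ (transferable-terms ts)))
        where
        ρ : Vec (Fin (ℕ.suc k + n)) (ℕ.suc n)
        ρ = zero ∷ rights (ℕ.suc k) n

        σ : Vec (Fin (ℕ.suc k + n)) (k + n)
        σ = rights 1 (k + n)

        eqρ : ∀ y (z : Vec Carrier k) x → ((y ∷ z) ++ x) ! ρ ≡ y ∷ x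
        eqρ y z x = cong (y ∷_) (!-rights (y ∷ z) x)

        to : ∀ y w {x′ x} → (y ∷ w) ! ρ ≡ eval x′ t ∷ x′ →
             (y ∷ w) ! σ ≡ evals x ts ++ x → termsGraph (t ∷ ts) (y ∷ w)
        to y w {x = x} p q with trans (sym (!-rights (y ∷ []) w)) q
        ... | refl with ∷-injective (trans (sym (eqρ y (evals x ts) x)) p)
        ...   | refl , refl = x , refl

-- Solution sets of formulas

      transferable-formula : (φ : BasicFormula language n) → Transferable (_⊨ φ)
      transferable-formula {n = n} (rel {k = k} R ts) = transferable-cong
        ( (λ {x} (z , (x′ , p) , h) → to x z p h)
        , (λ { {x} (rel h) →
                 evals x ts , (x , eqρ x (evals x ts))
               , subst ⟦ R ⟧ʳ (sym (!-rights x (evals x ts))) h }))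
        (transferable-∃ (transferable-∩
          (transferable-rearrange ρ (transferable-terms ts))
          (transferable-rearrange (rights n k) (rels k R))))
        where
        ρ : Vec (Fin (n + k)) (k + n)
        ρ = rights n k ++ lefts n k

        eqρ : ∀ (x : Vec Carrier n) z → (x ++ z) ! ρ ≡ z ++ x
        eqρ x z = trans (!-++ (x ++ z) (rights n k) _)
                        (cong₂ _++_ (!-rights x z) (!-lefts x z))

        to : ∀ x z {x′} → (x ++ z) ! ρ ≡ evals x′ ts ++ x′ →
             ⟦ R ⟧ʳ ((x ++ z) ! rights n k) → x ⊨ rel R ts
        to x z {x′} p h
          with ++-injective z (evals x′ ts) (trans (sym (eqρ x z)) p)
        ... | refl , refl = rel (subst ⟦ R ⟧ʳ (!-rights x z) h)
      -- The two graphs share the common value z of the terms t and u.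
      transferable-formula {n = n} (equ t u) = transferable-cong
        ( (λ { {x} (z ∷ [] , (x′ , p) , (x″ , q)) → to x z p q })
        , (λ { {x} (equ h) →
                 eval x t ∷ [] , (x , eqρ x (eval x t))
               , (x , trans (eqρ x (eval x t)) (cong (_∷ x) h)) }))
        (transferable-∃ (transferable-∩
          (transferable-rearrange ρ (transferable-term t))
          (transferable-rearrange ρ (transferable-term u))))
        where
        ρ : Vec (Fin (n + 1)) (1 + n)
        ρ = rights n 1 ++ lefts n 1

        eqρ : ∀ (x : Vec Carrier n) z → (x ++ (z ∷ [])) ! ρ ≡ z ∷ x
        eqρ x z = trans (!-++ (x ++ (z ∷ [])) (rights n 1) _)
                        (cong₂ _++_ (!-rights x (z ∷ [])) (!-lefts x (z ∷ [])))

        to : ∀ x z {x′ x″} → (x ++ (z ∷ [])) ! ρ ≡ eval x′ t ∷ x′ →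
             (x ++ (z ∷ [])) ! ρ ≡ eval x″ u ∷ x″ → x ⊨ equ t u
        to x z p q
          with ∷-injective (trans (sym (eqρ x z)) p)
             | ∷-injective (trans (sym (eqρ x z)) q)
        ... | t≡z , refl | u≡z , refl = equ (trans (sym t≡z) u≡z)

      transferable-conjunction : (fs : List (BasicFormula language n)) →
                                 Transferable (λ v → All (v ⊨_) fs)
      transferable-conjunction List.[] = transferable-cong
        ((λ _ → All.[]) , _) transferable-U
      transferable-conjunction (φ List.∷ fs) = transferable-cong
        ((λ (h , hs) → h All.∷ hs) , (λ { (h All.∷ hs) → h , hs }))
        (transferable-∩ (transferable-formula φ) (transferable-conjunction fs))

theorem1p7 :
  ∀ {r₁ ℓ₁ s₁ r₂ ℓ₂ s₂ e p}
  (𝓡₁ : SetWithLanguage r₁ ℓ₁ s₁) (𝓡₂ : SetWithLanguage r₂ ℓ₂ s₂) →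
  let module R₁ = SetWithLanguage 𝓡₁
      module R₂ = SetWithLanguage 𝓡₂ in
  (_∼_ : Rel R₂.Carrier e) (∼-equiv : IsEquivalence _∼_)
  (d : setoid R₁.Carrier ⟶ₛ Quotient ∼-equiv) →
  Injective _≡_ _∼_ (d ⟨$⟩_) →
  (∀ (c : R₁.ConSym) → IsDiophantine 𝓡₂ (overline d ｛ R₁.⟦ c ⟧ᶜ ∷ [] ｝)) →
  (∀ k (f : R₁.FunSym k) → IsDiophantine 𝓡₂ (overline d (graph R₁.⟦ f ⟧ᶠ))) →
  (∀ k (S : R₁.RelSym k) → IsDiophantine 𝓡₂ (overline d R₁.⟦ S ⟧ʳ)) →
  IsDiophantine 𝓡₂ (overline d {k = 1} U) →
  (IsDiophantine 𝓡₂ (pairs _∼_)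
    ⊎ IsDiophantine 𝓡₂ (pairs λ x y →
        (overline d U (x ∷ []) × overline d U (y ∷ [])) × x ∼ y)) →
  IsDiophantineEquivalenceMap p 𝓡₁ 𝓡₂ d
theorem1p7 𝓡₁ 𝓡₂ _∼_ ∼-equiv d inj cons funs rels range equality k S
  (l , fs , to , from) =
  transferable-cong
    ((λ (y , h) → from (y , h)) , to)
    (transferable-∃ (transferable-conjunction range
      (transferable-≡ range equality) cons funs rels fs))
  where
  open Transfer 𝓡₁ 𝓡₂ ∼-equiv d inj
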